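{- Let $G$ be a Polish group, let $\ell(*)<\omega$, and for each $\ell<\ell(*)$ let $n(\ell)<\omega$, let $A_\ell\in[\omega_1]^{\aleph_1}$, and let $(\bar{g}^\ell_\alpha : \alpha\in A_\ell)$ be a sequence with $\bar{g}^\ell_\alpha\in G^{n(\ell)}$ for all $\alpha\in A_\ell$. Let $\Delta$ be a finite set of quantifier-free formulas of the form $\varphi(\bar{x}^0,\ldots,\bar{x}^{\ell(*)-1})$ in the language of group theory, where $\bar{x}^\ell$ is a tuple of variables of length $n(\ell)$. Then there are $B_\ell\in[A_\ell]^{\aleph_1}$, for $\ell<\ell(*)$, and truth values $t_\varphi\in\{0,1\}$, for $\varphi\in\Delta$, such that for every $\varphi\in\Delta$ and every choice of $\alpha(\ell)\in B_\ell$, for $\ell<\ell(*)$, $$G\models\varphi^{t_\varphi}(\bar{g}^0_{\alpha(0)},\ldots,\bar{g}^{\ell(*)-1}_{\alpha(\ell(*)-1)}).$$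
   Context: For a set $X$, $[X]^{\aleph_1}$ denotes the set of subsets of $X$ of cardinality $\aleph_1$. For a formula $\varphi$ and a truth value $t\in\{0,1\}$, $\varphi^1$ is $\varphi$ and $\varphi^0$ is $\neg\varphi$. The language of group theory is $\{e,\cdot,(\ )^{ -1}\}$. A Polish group is a topological group whose topology is separable and completely metrizable. -}

module Defs where

open import Algebra.Bundles using (Group)
open import Data.Bool.Base using (Bool; true; false)
open import Data.Empty using (⊥-elim)
open import Data.Fin.Base using (Fin)
open import Data.Nat.Base as ℕ using (ℕ)
open import Data.Product.Base using (Σ; ∃; Σ-syntax; ∃-syntax; _×_; _,_; proj₁; proj₂)
open import Data.Product.Relation.Binary.Pointwise.NonDependent using (×-setoid)
open import Data.Rational.Base as ℚ using (ℚ; 0ℚ; 1ℚ)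
import Data.Rational.Properties as ℚ
open import Data.Sum.Base using (_⊎_)
open import Data.Unit.Polymorphic.Base using (tt)
import Data.Vec.Functional.Relation.Binary.Equality.Setoid as VecEq
open import Function.Base using (_∘_)
open import Function.Bundles using (Injection; Bijection; _⇔_)
open import Function.Metric.Structures using (IsGeneralMetric)
open import Induction.WellFounded using (WellFounded)
open import Level using (Level; 0ℓ; suc; _⊔_)
open import Relation.Binary.Bundles using (Setoid; StrictTotalOrder)
open import Relation.Binary.Definitions using (_Respects_; tri<; tri≈; tri>)
import Relation.Binary.Construct.On as On
open import Relation.Binary.PropositionalEquality as ≡ using (_≡_; refl)
open import Relation.Nullary.Negation using (¬_)
open import Relation.Unary
  using (Pred; _∈_; _⊆_; _≐_; _∩_; _≬_; ⋃; Satisfiable; _⟨×⟩_)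
open import Relation.Unary.Polymorphic using (U)

private
  variable
    a b c ℓ o p r s : Level

-- A set is a setoid, so a subset must be closed under its equality.
record Subset (X : Setoid a r) (p : Level) : Set (a ⊔ r ⊔ suc p) where
  open Setoid X
  field
    pred : Pred Carrier p
    resp : pred Respects _≈_

⟪_⟫ : {X : Setoid a r} → Subset X p → Setoid (a ⊔ p) r
⟪_⟫ {X = X} A = On.setoid {B = ∃ (Subset.pred A)} X proj₁

-- Countable includes finite and empty.
Countable : Setoid a r → Set (a ⊔ r)
Countable X = Injection X (≡.setoid ℕ)

module _ (W : StrictTotalOrder a r s) where
  open StrictTotalOrder W

  initialSegment : Carrier → Subset Eq.setoid s
  initialSegment α = record { pred = _< α ; resp = <-respˡ-≈ }

-- ω₁ is the least uncountable ordinal: any uncountable well-order all of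
-- whose proper initial segments are countable (classically, unique up to
-- isomorphism).
record Omega₁ (a r s : Level) : Set (suc (a ⊔ r ⊔ s)) where
  field
    order       : StrictTotalOrder a r s
  open StrictTotalOrder order public using (Carrier; _<_; module Eq)
  field
    wellFounded : WellFounded _<_
    uncountable : ¬ Countable Eq.setoid
    countable<  : ∀ α → Countable ⟪ initialSegment order α ⟫

  setoid : Setoid a r
  setoid = Eq.setoid

-- The elements of [X]^ℵ₁, where ℵ₁ is the cardinality of Ω.
record ℵ₁-Subset (Ω : Omega₁ a r s) (X : Setoid b ℓ) (p : Level)
                 : Set (a ⊔ r ⊔ b ⊔ ℓ ⊔ suc p) where
  field
    subset : Subset X p
    card   : Bijection ⟪ subset ⟫ (Omega₁.setoid Ω)

  elements : Setoid (b ⊔ p) ℓ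
  elements = ⟪ subset ⟫

-- A real is its lower Dedekind cut; classically no upper cut or locatedness is
-- needed.
record ℝ : Set₁ where
  field
    cut       : Pred ℚ 0ℓ
    inhabited : Satisfiable cut
    bounded   : ∃[ q ] ¬ cut q
    lower     : ∀ {p q} → p ℚ.< q → cut q → cut p
    rounded   : ∀ {p} → cut p → ∃[ q ] p ℚ.< q × cut q

open ℝ using (cut)

infix 4 _≤ᴿ_ _≃ᴿ_ _<ᴿ_
infixl 6 _+ᴿ_

_≤ᴿ_ _≃ᴿ_ _<ᴿ_ : ℝ → ℝ → Set
x ≤ᴿ y = cut x ⊆ cut y
x ≃ᴿ y = cut x ≐ cut y
x <ᴿ y = ∃[ q ] cut y q × ¬ cut x q

0ᴿ : ℝ
0ᴿ = record
  { cut       = ℚ._< 0ℚ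
  ; inhabited = ℚ.- 1ℚ , ℚ.negative⁻¹ (ℚ.- 1ℚ)
  ; bounded   = 0ℚ , ℚ.<-irrefl refl
  ; lower     = ℚ.<-trans
  ; rounded   = λ p<0 → ℚ.<-dense p<0
  }

private
  below : (x : ℝ) {p q : ℚ} → cut x p → ¬ cut x q → p ℚ.< q
  below x {p} {q} p∈x q∉x = ℚ.≰⇒> λ q≤p → q∉x (down q≤p)
    where
    down : q ℚ.≤ p → cut x q
    down q≤p with ℚ.<-cmp q p
    ... | tri< q<p _ _  = ℝ.lower x q<p p∈x
    ... | tri≈ _ refl _ = p∈x
    ... | tri> _ _ p<q  = ⊥-elim (ℚ.<-irrefl refl (ℚ.<-≤-trans p<q q≤p))

  p+[r-p]≡r : ∀ p r → r ≡ p ℚ.+ (ℚ.- p ℚ.+ r)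
  p+[r-p]≡r p r = begin
    r                     ≡⟨ ℚ.+-identityˡ r ⟨
    0ℚ ℚ.+ r              ≡⟨ ≡.cong (ℚ._+ r) (ℚ.+-inverseʳ p) ⟨
    (p ℚ.- p) ℚ.+ r       ≡⟨ ℚ.+-assoc p (ℚ.- p) r ⟩
    p ℚ.+ (ℚ.- p ℚ.+ r)   ∎
    where open ≡.≡-Reasoning

  [-p]+[p+q]≡q : ∀ p q → ℚ.- p ℚ.+ (p ℚ.+ q) ≡ q
  [-p]+[p+q]≡q p q = begin
    ℚ.- p ℚ.+ (p ℚ.+ q)   ≡⟨ ℚ.+-assoc (ℚ.- p) p q ⟨
    (ℚ.- p ℚ.+ p) ℚ.+ q   ≡⟨ ≡.cong (ℚ._+ q) (ℚ.+-inverseˡ p) ⟩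
    0ℚ ℚ.+ q              ≡⟨ ℚ.+-identityˡ q ⟩
    q                     ∎
    where open ≡.≡-Reasoning

_+ᴿ_ : ℝ → ℝ → ℝ
x +ᴿ y = record
  { cut       = λ r → ∃[ p ] ∃[ q ] cut x p × cut y q × r ≡ p ℚ.+ q
  ; inhabited = let p , p∈x = ℝ.inhabited x
                    q , q∈y = ℝ.inhabited y
                in p ℚ.+ q , p , q , p∈x , q∈y , refl
  ; bounded   = let m , m∉x = ℝ.bounded x
                    n , n∉y = ℝ.bounded y
                in m ℚ.+ n , λ (p , q , p∈x , q∈y , eq) →
                     ℚ.<-irrefl (≡.sym eq)
                       (ℚ.+-mono-< (below x p∈x m∉x) (below y q∈y n∉y))
  ; lower     = λ { {r} r<p+q (p , q , p∈x , q∈y , refl) →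
                    p , ℚ.- p ℚ.+ r , p∈x
                    , ℝ.lower y (≡.subst (ℚ.- p ℚ.+ r ℚ.<_) ([-p]+[p+q]≡q p q)
                                         (ℚ.+-monoʳ-< (ℚ.- p) r<p+q)) q∈y
                    , p+[r-p]≡r p r }
  ; rounded   = λ { (p , q , p∈x , q∈y , refl) →
                    let p′ , p<p′ , p′∈x = ℝ.rounded x p∈x
                    in p′ ℚ.+ q , ℚ.+-monoˡ-< q p<p′
                       , p′ , q , p′∈x , q∈y , refl }
  }

-- Unions are over small families; classically this is no restriction, since one
-- open set per point of a union suffices.
record Topology (X : Setoid c ℓ) (o : Level) : Set (suc (c ⊔ ℓ ⊔ o)) where
  open Setoid X
  field
    Open      : Pred (Pred Carrier (c ⊔ ℓ)) o
    open-resp : ∀ {V} → Open V → V Respects _≈_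
    open-ext  : ∀ {V W} → V ≐ W → Open V → Open W
    open-U    : Open U
    open-∩    : ∀ {V W} → Open V → Open W → Open (V ∩ W)
    open-⋃    : ∀ {I : Set (c ⊔ ℓ)} {V : I → Pred Carrier (c ⊔ ℓ)} →
                (∀ i → Open (V i)) → Open (⋃ I V)

open Topology using (Open)

productTopology : {X Y : Setoid c ℓ} → Topology X o → Topology Y o →
                  Topology (×-setoid X Y) (suc (c ⊔ ℓ) ⊔ o)
productTopology S T = record
  { Open      = λ Q → ∀ {x y} → Q (x , y) →
                ∃[ V ] ∃[ W ] Open S V × Open T W × x ∈ V × y ∈ W × (V ⟨×⟩ W) ⊆ Q
  ; open-resp = λ Q-open (x≈x′ , y≈y′) xy∈Q →
                let _ , _ , V-open , W-open , x∈V , y∈W , V×W⊆Q = Q-open xy∈Q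
                in V×W⊆Q ( Topology.open-resp S V-open x≈x′ x∈V
                         , Topology.open-resp T W-open y≈y′ y∈W)
  ; open-ext  = λ (P⊆Q , Q⊆P) P-open xy∈Q →
                let V , W , V-open , W-open , x∈V , y∈W , V×W⊆P = P-open (Q⊆P xy∈Q)
                in V , W , V-open , W-open , x∈V , y∈W , λ z → P⊆Q (V×W⊆P z)
  ; open-U    = λ _ → U , U , Topology.open-U S , Topology.open-U T , tt , tt , λ _ → tt
  ; open-∩    = λ P-open Q-open (xy∈P , xy∈Q) →
                let V₁ , W₁ , V₁-open , W₁-open , x∈V₁ , y∈W₁ , ⊆P = P-open xy∈P
                    V₂ , W₂ , V₂-open , W₂-open , x∈V₂ , y∈W₂ , ⊆Q = Q-open xy∈Q
                in V₁ ∩ V₂ , W₁ ∩ W₂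
                   , Topology.open-∩ S V₁-open V₂-open
                   , Topology.open-∩ T W₁-open W₂-open
                   , (x∈V₁ , x∈V₂) , (y∈W₁ , y∈W₂)
                   , λ ((v₁ , v₂) , (w₁ , w₂)) → ⊆P (v₁ , w₁) , ⊆Q (v₂ , w₂)
  ; open-⋃    = λ Q-open (i , xy∈Qᵢ) →
                let V , W , V-open , W-open , x∈V , y∈W , V×W⊆Qᵢ = Q-open i xy∈Qᵢ
                in V , W , V-open , W-open , x∈V , y∈W , λ z → i , V×W⊆Qᵢ z
  }

Continuous : ∀ {o o′} {X Y : Setoid c ℓ} → Topology X o → Topology Y o′ →
             (Setoid.Carrier X → Setoid.Carrier Y) → Set (suc (c ⊔ ℓ) ⊔ o ⊔ o′)
Continuous S T f = ∀ {V} → Open T V → Open S (V ∘ f)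

Separable : {X : Setoid c ℓ} → Topology X o → Set (suc (c ⊔ ℓ) ⊔ o)
Separable {c} {ℓ} {X = X} T =
  Σ[ D ∈ Subset X (c ⊔ ℓ) ]
    Countable ⟪ D ⟫ × (∀ {V} → Open T V → Satisfiable V → Subset.pred D ≬ V)

module _ (X : Setoid c ℓ) where
  open Setoid X

  IsMetric : (Carrier → Carrier → ℝ) → Set (suc 0ℓ ⊔ c ⊔ ℓ)
  IsMetric = IsGeneralMetric _≈_ _≃ᴿ_ _≤ᴿ_ 0ᴿ _+ᴿ_

  module _ (d : Carrier → Carrier → ℝ) where

    Ball : Carrier → ℝ → Pred Carrier 0ℓ
    Ball x ε y = d x y <ᴿ ε

    Induces : Topology X o → Set (suc (c ⊔ ℓ) ⊔ suc 0ℓ ⊔ o)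
    Induces T = ∀ V → Open T V ⇔
      (V Respects _≈_ × (∀ {x} → x ∈ V → ∃[ ε ] 0ᴿ <ᴿ ε × Ball x ε ⊆ V))

    Cauchy : (ℕ → Carrier) → Set₁
    Cauchy x = ∀ ε → 0ᴿ <ᴿ ε →
      ∃[ N ] ∀ m n → N ℕ.≤ m → N ℕ.≤ n → d (x m) (x n) <ᴿ ε

    _ConvergesTo_ : (ℕ → Carrier) → Carrier → Set₁
    x ConvergesTo y = ∀ ε → 0ᴿ <ᴿ ε → ∃[ N ] ∀ n → N ℕ.≤ n → d (x n) y <ᴿ ε

    Complete : Set (suc 0ℓ ⊔ c)
    Complete = ∀ x → Cauchy x → ∃[ y ] x ConvergesTo y

CompletelyMetrizable : {X : Setoid c ℓ} → Topology X o → Set (suc (c ⊔ ℓ) ⊔ suc 0ℓ ⊔ o)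
CompletelyMetrizable {X = X} T =
  ∃[ d ] IsMetric X d × Complete X d × Induces X d T

record PolishGroup (c ℓ o : Level) : Set (suc (c ⊔ ℓ ⊔ o)) where
  field
    group                : Group c ℓ
  open Group group public
  field
    topology             : Topology setoid o
    ∙-continuous         : Continuous (productTopology topology topology) topology
                                      (λ (x , y) → x ∙ y)
    ⁻¹-continuous        : Continuous topology topology _⁻¹
    separable            : Separable topology
    completelyMetrizable : CompletelyMetrizable topology

data Term (V : Set) : Set where
  var  : V → Term V
  e    : Term V
  _·_  : Term V → Term V → Term V
  _⁻¹′ : Term V → Term V

data QFFormula (V : Set) : Set where
  _≐′_ : Term V → Term V → QFFormula V
  ¬′_  : QFFormula V → QFFormula V
  _∧′_ : QFFormula V → QFFormula V → QFFormula V
  _∨′_ : QFFormula V → QFFormula V → QFFormula V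
  _⇒′_ : QFFormula V → QFFormula V → QFFormula V

_^_ : {V : Set} → QFFormula V → Bool → QFFormula V
φ ^ true  = φ
φ ^ false = ¬′ φ

module _ (G : Group c ℓ) {V : Set} where
  open Group G

  ⟦_⟧ : Term V → (V → Carrier) → Carrier
  ⟦ var v ⟧ ρ = ρ v
  ⟦ e ⟧     ρ = ε
  ⟦ x · y ⟧ ρ = ⟦ x ⟧ ρ ∙ ⟦ y ⟧ ρ
  ⟦ x ⁻¹′ ⟧ ρ = ⟦ x ⟧ ρ ⁻¹

  infix 4 _⊨_[_]

  _⊨_[_] : QFFormula V → (V → Carrier) → Set ℓ
  _⊨_[_] (x ≐′ y) ρ = ⟦ x ⟧ ρ ≈ ⟦ y ⟧ ρ
  _⊨_[_] (¬′ φ)   ρ = ¬ _⊨_[_] φ ρ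
  _⊨_[_] (φ ∧′ ψ) ρ = _⊨_[_] φ ρ × _⊨_[_] ψ ρ
  _⊨_[_] (φ ∨′ ψ) ρ = _⊨_[_] φ ρ ⊎ _⊨_[_] ψ ρ
  _⊨_[_] (φ ⇒′ ψ) ρ = _⊨_[_] φ ρ → _⊨_[_] ψ ρ

-- Variables x̄⁰, …, x̄ᵏ⁻¹, where x̄ˡ has length n l.
Var : {k : ℕ} → (Fin k → ℕ) → Set
Var {k} n = Σ[ l ∈ Fin k ] Fin (n l)

_^ᵍ_ : Group c ℓ → ℕ → Setoid c ℓ
G ^ᵍ m = VecEq.≋-setoid (Group.setoid G) m

{-# OPTIONS --safe #-}

-- A condensation point of an uncountable family is a member all of whose basic
-- neighbourhoods contain uncountably many members. As G has a countable network,
-- all but countably many members of an uncountable family are condensation points.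
-- Given an equation, either it holds at all tuples of condensation points, or it
-- fails at one of them, hence, by continuity, on a product of neighbourhoods, each
-- of which contains uncountably many members. Either way uncountable subfamilies
-- decide it; iterating over the equations occurring in Δ decides every formula.
--
-- Excluded middle at a Σ-type returns a witness, so it also serves as a choice
-- principle, but the chosen witness need not respect setoid equality.
module Submission where

import Algebra.Properties.Group as GroupProperties
open import Axiom.ExcludedMiddle using (ExcludedMiddle)
open import Data.Bool.Base using (Bool)
open import Data.Empty using (⊥-elim)
open import Data.Fin.Base using (Fin)
open import Data.Integer.Base using (ℤ; +_; -[1+_])
open import Data.List.Base using (List; []; _∷_)
open import Data.List.Membership.Propositional using (_∈_)
open import Data.List.Relation.Unary.All as All using (All; []; _∷_)
open import Data.Maybe.Base using (Maybe; just; nothing)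
open import Data.Nat.Base using (ℕ; zero; suc; _+_; _*_; _≤_; _<_)
open import Data.Nat.Induction using (<-wellFounded)
import Data.Nat.Properties as ℕ
open import Data.Product.Base using (Σ-syntax; ∃; ∃-syntax; _×_; _,_; proj₁; proj₂)
open import Data.Product.Function.NonDependent.Propositional using (_×-↣_)
open import Data.Rational.Base as ℚ using (ℚ; mkℚ; 0ℚ; 1ℚ; ½)
import Data.Rational.Properties as ℚ
open import Data.Sum.Base using (inj₁; inj₂)
open import Data.Unit.Polymorphic.Base using (tt)
open import Data.Vec.Base using (Vec; []; _∷_; lookup; tabulate)
open import Data.Vec.Properties using (lookup∘tabulate)
open import Function.Base using (_∘_)
open import Function.Bundles using (Func; Injection; Bijection; Equivalence; _↣_; mk↣)
open import Function.Metric.Structures using (IsGeneralMetric)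
open import Function.Properties.Injection using (↣-refl; ↣-trans)
import Function.Properties.Inverse as Inverse
open import Function.Properties.Bijection using (Bijection⇒Inverse)
open import Induction.WellFounded using (WellFounded; Acc; acc)
open import Level using (Level; Lift; lift; lower; _⊔_)
open import Relation.Binary.Bundles using (Setoid; StrictTotalOrder)
import Relation.Binary.Construct.On as On
open import Relation.Binary.Core using (Rel)
open import Relation.Binary.Definitions using (tri<; tri≈; tri>)
open import Relation.Binary.PropositionalEquality as ≡ using (_≡_; refl)
open import Relation.Nullary using (Dec; yes; no; does; ¬_)
open import Relation.Nullary.Decidable using (decidable-stable; True; toWitness; fromWitness)
open import Relation.Unary using (Pred; _⊆_; _≐_; Satisfiable)
open import Relation.Unary.Polymorphic using (U)
open import Defs

private
  variable
    a b c i ℓ o p q r s : Level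
    A C : Set

-- Countability of the index types: pairs, vectors, rationals.

square+≤-mono-< : ∀ {s t m} → s < t → m ≤ s → s * s + m < t * t
square+≤-mono-< {s} {t} {m} s<t m≤s = begin-strict
  s * s + m      ≤⟨ ℕ.+-monoʳ-≤ (s * s) m≤s ⟩
  s * s + s      ≡⟨ ℕ.+-comm (s * s) s ⟩
  s + s * s      <⟨ ℕ.n<1+n _ ⟩
  suc s + s * s  ≤⟨ ℕ.+-monoʳ-≤ (suc s) (ℕ.*-monoʳ-≤ s (ℕ.n≤1+n s)) ⟩
  suc s * suc s  ≤⟨ ℕ.*-mono-≤ s<t s<t ⟩
  t * t          ∎
  where open ℕ.≤-Reasoning

-- As m ≤ m + n, the code (m + n)² + m lies below the next square. It therefore determines m + n,
-- then m by cancelling the square, then n.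
ℕ×ℕ↣ℕ : (ℕ × ℕ) ↣ ℕ
ℕ×ℕ↣ℕ = mk↣ {to = pair} λ {x} {y} → pair-injective x y
  where
  pair : ℕ × ℕ → ℕ
  pair (m , n) = (m + n) * (m + n) + m

  pair-mono : ∀ x y → proj₁ x + proj₂ x < proj₁ y + proj₂ y → pair x < pair y
  pair-mono (m , n) (m′ , n′) lt =
    ℕ.<-≤-trans (square+≤-mono-< lt (ℕ.m≤m+n m n)) (ℕ.m≤m+n _ m′)

  pair-injective : ∀ x y → pair x ≡ pair y → x ≡ y
  pair-injective x@(m , n) y@(m′ , n′) eq with ℕ.<-cmp (m + n) (m′ + n′)
  ... | tri< lt _ _ = ⊥-elim (ℕ.<⇒≢ (pair-mono x y lt) eq)
  ... | tri> _ _ gt = ⊥-elim (ℕ.<⇒≢ (pair-mono y x gt) (≡.sym eq))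
  ... | tri≈ _ sum≡ _
    with refl ← ℕ.+-cancelˡ-≡ ((m + n) * (m + n)) m m′
           (≡.trans eq (≡.cong (λ z → z * z + m′) (≡.sym sum≡)))
    with refl ← ℕ.+-cancelˡ-≡ m n n′ sum≡ = refl

×-countable : A ↣ ℕ → C ↣ ℕ → (A × C) ↣ ℕ
×-countable f g = ↣-trans (f ×-↣ g) ℕ×ℕ↣ℕ

Maybe-countable : A ↣ ℕ → Maybe A ↣ ℕ
Maybe-countable {A} f = ↣-trans (mk↣ {to = to} inj) ℕ×ℕ↣ℕ
  where
  to : Maybe A → ℕ × ℕ
  to nothing  = 0 , 0
  to (just x) = 1 , Injection.to f x

  inj : ∀ {x y} → to x ≡ to y → x ≡ y
  inj {nothing} {nothing} _  = refl
  inj {just _}  {just _}  eq = ≡.cong just (Injection.injective f (≡.cong proj₂ eq))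

Vec-countable : A ↣ ℕ → ∀ n → Vec A n ↣ ℕ
Vec-countable f zero    = mk↣ {to = λ _ → 0} λ { {[]} {[]} _ → refl }
Vec-countable f (suc n) =
  ↣-trans (mk↣ {to = λ { (x ∷ xs) → x , xs }} λ { {_ ∷ _} {_ ∷ _} refl → refl })
          (×-countable f (Vec-countable f n))

-- The choices are stored in a vector because vectors over a countable type are countable for
-- propositional equality; for functions on `Fin n` this would call for extensionality.
Vec-choice : ∀ {n} {P : Fin n → A → Set p} → (∀ i → ∃ (P i)) →
             ∃[ v ] (∀ i → P i (lookup v i))
Vec-choice {P = P} f = tabulate (proj₁ ∘ f) ,
  λ i → ≡.subst (P i) (≡.sym (lookup∘tabulate (proj₁ ∘ f) i)) (proj₂ (f i))

ℤ-countable : ℤ ↣ ℕ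
ℤ-countable = ↣-trans (mk↣ {to = to} inj) ℕ×ℕ↣ℕ
  where
  to : ℤ → ℕ × ℕ
  to (+ n)    = 0 , n
  to -[1+ n ] = 1 , n

  inj : ∀ {x y} → to x ≡ to y → x ≡ y
  inj {+ _}      {+ _}      refl = refl
  inj { -[1+ _ ]} { -[1+ _ ]} refl = refl

ℚ-countable : ℚ ↣ ℕ
ℚ-countable = ↣-trans (mk↣ {to = λ x → ℚ.numerator x , ℚ.denominator-1 x}
                           λ { {mkℚ _ _ _} {mkℚ _ _ _} refl → refl })
                      (×-countable ℤ-countable ↣-refl)

-- Subsets of setoids and minimal elements.

empty-countable : {X : Setoid a r} → ¬ Setoid.Carrier X → Countable X
empty-countable ∅ = record
  { to        = λ _ → 0
  ; cong      = λ _ → refl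
  ; injective = λ {x} _ → ⊥-elim (∅ x)
  }

⟪⟫-mono : {X : Setoid a r} {S : Subset X p} {T : Subset X q} →
          Subset.pred S ⊆ Subset.pred T → Injection ⟪ S ⟫ ⟪ T ⟫
⟪⟫-mono S⊆T = record
  { to        = λ (x , x∈S) → x , S⊆T x∈S
  ; cong      = λ x≈y → x≈y
  ; injective = λ x≈y → x≈y
  }

⟪⟫-embed : {X : Setoid a r} (S : Subset X p) → Injection ⟪ S ⟫ X
⟪⟫-embed S = record { to = proj₁ ; cong = λ x≈y → x≈y ; injective = λ x≈y → x≈y }

_∩ˢ_ : {X : Setoid a r} → Subset X p → Subset X q → Subset X (p ⊔ q)
S ∩ˢ T = record
  { pred = λ x → Subset.pred S x × Subset.pred T x
  ; resp = λ x≈y (x∈S , x∈T) → Subset.resp S x≈y x∈S , Subset.resp T x≈y x∈T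
  }

IsMinimal : {A : Set a} → Rel A r → Pred A p → Pred A (a ⊔ r ⊔ p)
IsMinimal _<_ P x = P x × (∀ {y} → P y → ¬ y < x)

module _ (O : StrictTotalOrder a r s) where
  open StrictTotalOrder O renaming (Carrier to W; _<_ to _≺_)

  -- Equal setoid elements give rise to equivalent predicates, not identical ones, hence the two
  -- predicates `P` and `Q`. This is how classically chosen minima come to respect setoid equality.
  IsMinimal-unique : {P : Pred W p} {Q : Pred W q} → P ≐ Q →
                     ∀ {x y} → IsMinimal _≺_ P x → IsMinimal _≺_ Q y → x ≈ y
  IsMinimal-unique (P⊆Q , Q⊆P) {x} {y} (x∈P , x-min) (y∈Q , y-min) with compare x y
  ... | tri< x<y _ _ = ⊥-elim (y-min (P⊆Q x∈P) x<y)
  ... | tri≈ _ x≈y _ = x≈y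
  ... | tri> _ _ y<x = ⊥-elim (x-min (Q⊆P y∈Q) y<x)

-- Classical tools: minimal elements, change of universe level, countable unions.

module Classical (em : ∀ {e : Level} → ExcludedMiddle e) where

  dne : {P : Set a} → ¬ ¬ P → P
  dne = decidable-stable em

  minimal : {A : Set a} {_<_ : Rel A r} → WellFounded _<_ →
            (P : Pred A p) → Satisfiable P → ∃ (IsMinimal _<_ P)
  minimal {_<_ = _<_} wf P (x , x∈P) = descend x (wf x) x∈P
    where
    descend : ∀ x → Acc _<_ x → P x → ∃ (IsMinimal _<_ P)
    descend x (acc rs) x∈P with em {P = ∃[ y ] (P y × y < x)}
    ... | yes (y , y∈P , y<x) = descend y (rs y<x) y∈P
    ... | no  ∄y              = x , x∈P , λ y∈P y<x → ∄y (_ , y∈P , y<x)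

  -- The truth of a decision is a type of the lowest level, so it can be lifted to any level. This
  -- brings subsets defined from condensation points and network members back to the level required
  -- of a `Family`.
  resize : {X : Setoid a r} → Subset X q → Subset X p
  resize {p = p} S = record
    { pred = λ x → Lift p (True (em {P = Subset.pred S x}))
    ; resp = λ x≈y (lift x∈S) → lift (fromWitness (Subset.resp S x≈y (toWitness x∈S)))
    }

  resize-⊆ : {X : Setoid a r} {S : Subset X q} → Subset.pred (resize {p = p} S) ⊆ Subset.pred S
  resize-⊆ (lift x∈S) = toWitness x∈S

  resize-⊇ : {X : Setoid a r} {S : Subset X q} → Subset.pred S ⊆ Subset.pred (resize {p = p} S)
  resize-⊇ x∈S = lift (fromWitness x∈S)

  resize-uncountable : {X : Setoid a r} (S : Subset X q) →
                       ¬ Countable ⟪ S ⟫ → ¬ Countable ⟪ resize {p = p} S ⟫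
  resize-uncountable {p = p} S S-unc count =
    S-unc (↣-trans (⟪⟫-mono {S = S} {T = resize {p = p} S} (resize-⊇ {S = S})) count)

  -- Taking least labels produces a code that respects the equality of X, which
  -- an arbitrary choice of labels would not.
  labelled-countable : {I : Set} → I ↣ ℕ → {X : Setoid a r} (let open Setoid X using (_≈_))
                       (R : I → Subset X p) →
                       (∀ x → ∃[ i ] Subset.pred (R i) x) →
                       (∀ {i x y} → Subset.pred (R i) x → Subset.pred (R i) y → x ≈ y) →
                       Countable X
  labelled-countable {I = I} ι {X} R cover unique = record
    { to        = proj₁ ∘ code
    ; cong      = λ {x} {y} x≈y → IsMinimal-unique ℕ.<-strictTotalOrder
                    (transfer x≈y , transfer (sym x≈y)) (proj₂ (code x)) (proj₂ (code y))
    ; injective = λ {x} {y} → code-injective (code x) (code y)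
    }
    where
    open Setoid X using (Carrier; _≈_; sym)

    Label : Carrier → Pred ℕ _
    Label x m = ∃[ i ] (Injection.to ι i ≡ m × Subset.pred (R i) x)

    code : ∀ x → ∃ (IsMinimal _<_ (Label x))
    code x = minimal <-wellFounded (Label x) (let i , xRi = cover x in _ , i , refl , xRi)

    transfer : ∀ {x y} → x ≈ y → Label x ⊆ Label y
    transfer x≈y (i , eq , xRi) = i , eq , Subset.resp (R i) x≈y xRi

    code-injective : ∀ {x y} (m : ∃ (IsMinimal _<_ (Label x))) (n : ∃ (IsMinimal _<_ (Label y))) →
                     proj₁ m ≡ proj₁ n → x ≈ y
    code-injective (_ , (i , refl , xRi) , _) (_ , (j , eq , yRj) , _) refl
      with refl ← Injection.injective ι eq = unique xRi yRj

  -- An element is labelled by the index of a piece containing it together with its code in that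
  -- piece.
  ⋃-countable : {I : Set} → I ↣ ℕ → {X : Setoid a r} (P : I → Subset X p) →
                (∀ i → Countable ⟪ P i ⟫) →
                (∀ x → ∃[ i ] Subset.pred (P i) x) → Countable X
  ⋃-countable {p = p} {I = I} ι {X} P count cover =
    labelled-countable (×-countable ι ↣-refl) R
      (λ x → let i , x∈Pi = cover x in (i , _) , x∈Pi , refl)
      (λ { {i , _} (_ , eq) (_ , eq′) → Injection.injective (count i) (≡.trans eq (≡.sym eq′)) })
    where
    open Setoid X using (sym)

    R : I × ℕ → Subset X p
    R (i , m) = record
      { pred = λ x → Σ[ x∈Pi ∈ Subset.pred (P i) x ] Injection.to (count i) (x , x∈Pi) ≡ m
      ; resp = λ x≈y (x∈Pi , eq) →
          Subset.resp (P i) x≈y x∈Pi , ≡.trans (Injection.cong (count i) (sym x≈y)) eq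
      }

  -- Condensation points.

  module _ {X : Setoid a r} {I : Set} (S : Subset X p) (Q : I → Subset X q) where

    condensation : Subset X (a ⊔ r ⊔ p ⊔ q)
    condensation = record
      { pred = λ x → Subset.pred S x ×
                     (∀ i → Subset.pred (Q i) x → ¬ Countable ⟪ S ∩ˢ Q i ⟫)
      ; resp = λ x≈y (x∈S , large) → Subset.resp S x≈y x∈S ,
                 λ i y∈Q → large i (Subset.resp (Q i) (Setoid.sym X x≈y) y∈Q)
      }

    -- A member of `S` that is not a condensation point lies in some `Q i` meeting `S` in a
    -- countable set. There are countably many such pieces, so countably many condensation points
    -- would make `S` countable. The index `nothing` stands for the condensation points.
    condensation-uncountable : I ↣ ℕ → ¬ Countable ⟪ S ⟫ → ¬ Countable ⟪ condensation ⟫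
    condensation-uncountable ι S-unc cond-countable =
      S-unc (⋃-countable (Maybe-countable ι) P P-countable cover)
      where
      P : Maybe I → Subset ⟪ S ⟫ (a ⊔ r ⊔ p ⊔ q)
      P nothing = record
        { pred = λ (x , _) → Subset.pred condensation x
        ; resp = Subset.resp condensation
        }
      -- Countability is part of the predicate, so the piece is empty when `S ∩ˢ Q i` is
      -- uncountable, and every piece is countable.
      P (just i) = record
        { pred = λ (x , _) → Subset.pred (Q i) x × Countable ⟪ S ∩ˢ Q i ⟫
        ; resp = λ x≈y (x∈Q , count) → Subset.resp (Q i) x≈y x∈Q , count
        }

      P-countable : ∀ i → Countable ⟪ P i ⟫
      P-countable nothing = ↣-trans {T = ⟪ condensation ⟫}
        record { to = λ ((x , _) , x∈c) → x , x∈c ; cong = λ e → e ; injective = λ e → e }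
        cond-countable
      P-countable (just i) with em {P = Countable ⟪ S ∩ˢ Q i ⟫}
      ... | yes count = ↣-trans {T = ⟪ S ∩ˢ Q i ⟫}
        record { to = λ ((x , x∈S) , (x∈Q , _)) → x , (x∈S , x∈Q) ; cong = λ e → e ; injective = λ e → e }
        count
      ... | no  ¬count = empty-countable λ (_ , (_ , count)) → ¬count count

      cover : ∀ x → ∃[ i ] Subset.pred (P i) x
      cover (x , x∈S) with em {P = Subset.pred condensation x}
      ... | yes x∈c = nothing , x∈c
      ... | no  x∉c with em {P = ∃[ i ] (Subset.pred (Q i) x × Countable ⟪ S ∩ˢ Q i ⟫)}
      ...   | yes (i , h) = just i , h
      ...   | no  ∄i      = ⊥-elim (x∉c (x∈S , λ i x∈Q count → ∄i (i , x∈Q , count)))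

  -- Transfinite enumeration: α is sent to the first element of Y not yet listed.
  -- It exhausts Y because an element never listed would lie above an injective
  -- image of Ω.
  module _ (Ω : Omega₁ a r s) {Y : Setoid b ℓ} (rank : Injection Y (Omega₁.setoid Ω))
           (Y-unc : ¬ Countable Y) where
    open StrictTotalOrder (Omega₁.order Ω)
      renaming (Carrier to W; _<_ to _≺_; _≈_ to _≋_) hiding (trans)
    open Omega₁ Ω using (wellFounded; countable<; uncountable)
    open Setoid Y renaming (Carrier to E; refl to ≈-refl; sym to ≈-sym; trans to ≈-trans)
    private
      ∣_∣ : E → W
      ∣_∣ = Injection.to rank

      _⊏_ : Rel E s
      x ⊏ y = ∣ x ∣ ≺ ∣ y ∣

      default : E
      default = dne λ ∅ → Y-unc (empty-countable ∅)

    -- The default value makes first-cong hold for unsatisfiable predicates too, so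
    -- that enum respects ≋ before Fresh is known to be satisfiable.
    first : Pred E p → E
    first P with em {P = ∃ (IsMinimal _⊏_ P)}
    ... | yes (y , _) = y
    ... | no  _       = default

    first-minimal : (P : Pred E p) → Satisfiable P → IsMinimal _⊏_ P (first P)
    first-minimal P sat with em {P = ∃ (IsMinimal _⊏_ P)}
    ... | yes (_ , y-min) = y-min
    ... | no  ∄           = ⊥-elim (∄ (minimal (On.wellFounded ∣_∣ wellFounded) P sat))

    first-cong : {P : Pred E p} {Q : Pred E q} → P ≐ Q → first P ≈ first Q
    first-cong {P = P} {Q} P≐Q@(P⊆Q , Q⊆P)
      with em {P = ∃ (IsMinimal _⊏_ P)} | em {P = ∃ (IsMinimal _⊏_ Q)}
    ... | yes (_ , x-min) | yes (_ , y-min) =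
      Injection.injective rank
        (IsMinimal-unique (On.strictTotalOrder (Omega₁.order Ω) ∣_∣) P≐Q x-min y-min)
    ... | yes (x , x∈P , x-min) | no ∄ = ⊥-elim (∄ (x , P⊆Q x∈P , λ y∈Q → x-min (Q⊆P y∈Q)))
    ... | no ∄ | yes (y , y∈Q , y-min) = ⊥-elim (∄ (y , Q⊆P y∈Q , λ x∈P → y-min (P⊆Q x∈P)))
    ... | no _ | no _ = ≈-refl

    mutual
      enum : ∀ {α} → Acc _≺_ α → E
      enum h = first (Fresh h)

      Fresh : ∀ {α} → Acc _≺_ α → Pred E (a ⊔ s ⊔ ℓ)
      Fresh {α} (acc rs) y = ∀ {β} (β≺α : β ≺ α) → ¬ y ≈ enum (rs β≺α)

    -- Induction on accessibility: the earlier values agree, so the two `Fresh` predicates are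
    -- equivalent and `first-cong` applies. In particular the value does not depend on the
    -- accessibility proof.
    enum-cong : ∀ {α α′} (h : Acc _≺_ α) (h′ : Acc _≺_ α′) → α ≋ α′ → enum h ≈ enum h′
    enum-cong {α} {α′} (acc rs) (acc rs′) α≋α′ = first-cong (to , from)
      where
      to : Fresh (acc rs) ⊆ Fresh (acc rs′)
      to fresh β≺α′ y≈ = fresh β≺α (≈-trans y≈ (≈-sym (enum-cong (rs β≺α) (rs′ β≺α′) Eq.refl)))
        where β≺α = <-respʳ-≈ (Eq.sym α≋α′) β≺α′

      from : Fresh (acc rs′) ⊆ Fresh (acc rs)
      from fresh β≺α y≈ = fresh β≺α′ (≈-trans y≈ (enum-cong (rs β≺α) (rs′ β≺α′) Eq.refl))
        where β≺α′ = <-respʳ-≈ α≋α′ β≺α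

    -- Otherwise all of `Y` would be listed before stage α, and the countable initial segment below
    -- α would supply countably many labels for `Y`.
    Fresh-satisfiable : ∀ {α} (h : Acc _≺_ α) → Satisfiable (Fresh h)
    Fresh-satisfiable {α} h@(acc rs) with em {P = Satisfiable (Fresh h)}
    ... | yes sat = sat
    ... | no  ∄   = ⊥-elim (Y-unc (labelled-countable ↣-refl R cover unique))
      where
      R : ℕ → Subset Y (a ⊔ s ⊔ ℓ)
      R m = record
        { pred = λ y → ∃[ β ] Σ[ β≺α ∈ β ≺ α ]
                   (Injection.to (countable< α) (β , β≺α) ≡ m × y ≈ enum (rs β≺α))
        ; resp = λ x≈y (β , β≺α , eq , x≈) → β , β≺α , eq , ≈-trans (≈-sym x≈y) x≈
        }

      cover : ∀ y → ∃[ m ] Subset.pred (R m) y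
      cover y = dne λ ∄i → ∄ (y , λ β≺α y≈ → ∄i (_ , _ , β≺α , refl , y≈))

      unique : ∀ {m x y} → Subset.pred (R m) x → Subset.pred (R m) y → x ≈ y
      unique (β , β≺α , eq , x≈) (γ , γ≺α , eq′ , y≈) =
        ≈-trans x≈ (≈-trans (enum-cong (rs β≺α) (rs γ≺α) β≋γ) (≈-sym y≈))
        where β≋γ = Injection.injective (countable< α) (≡.trans eq (≡.sym eq′))

    enum-minimal : ∀ {α} (h : Acc _≺_ α) → IsMinimal _⊏_ (Fresh h) (enum h)
    enum-minimal h = first-minimal (Fresh h) (Fresh-satisfiable h)

    Fresh-earlier : ∀ {α β y} (h : Acc _≺_ α) (h′ : Acc _≺_ β) → β ≺ α → Fresh h y → ¬ y ≈ enum h′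
    Fresh-earlier (acc rs) h′ β≺α fresh y≈ = fresh β≺α (≈-trans y≈ (enum-cong h′ (rs β≺α) Eq.refl))

    enum-injective : ∀ {α β} (h : Acc _≺_ α) (h′ : Acc _≺_ β) → enum h ≈ enum h′ → α ≋ β
    enum-injective {α} {β} h h′ eq with compare α β
    ... | tri< α≺β _ _ = ⊥-elim (Fresh-earlier h′ h α≺β (proj₁ (enum-minimal h′)) (≈-sym eq))
    ... | tri≈ _ α≋β _ = α≋β
    ... | tri> _ _ β≺α = ⊥-elim (Fresh-earlier h h′ β≺α (proj₁ (enum-minimal h)) eq)

    Listed : E → Set (a ⊔ ℓ)
    Listed y = ∃[ α ] y ≈ enum (wellFounded α)

    enum-surjective : ∀ y → Listed y
    enum-surjective y = dne λ unlisted → uncountable (↣-trans (embed unlisted) (countable< ∣ y ∣))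
      where
      fresh : ¬ Listed y → ∀ {α} (h : Acc _≺_ α) → Fresh h y
      fresh unlisted (acc rs) β≺α y≈ =
        unlisted (_ , ≈-trans y≈ (enum-cong (rs β≺α) (wellFounded _) Eq.refl))

      -- An unlisted `y` is fresh at every stage, so the minimal choice never has larger rank; equal
      -- rank would list `y`.
      below : ¬ Listed y → ∀ α → enum (wellFounded α) ⊏ y
      below unlisted α with compare ∣ enum (wellFounded α) ∣ ∣ y ∣
      ... | tri< lt _ _ = lt
      ... | tri≈ _ eq _ = ⊥-elim (unlisted (α , ≈-sym (Injection.injective rank eq)))
      ... | tri> _ _ gt = ⊥-elim (proj₂ (enum-minimal (wellFounded α)) (fresh unlisted (wellFounded α)) gt)

      embed : ¬ Listed y → Injection (Omega₁.setoid Ω) ⟪ initialSegment (Omega₁.order Ω) ∣ y ∣ ⟫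
      embed unlisted = record
        { to        = λ α → ∣ enum (wellFounded α) ∣ , below unlisted α
        ; cong      = λ α≋β → Injection.cong rank (enum-cong (wellFounded _) (wellFounded _) α≋β)
        ; injective = λ eq → enum-injective (wellFounded _) (wellFounded _) (Injection.injective rank eq)
        }

    uncountable⇒bijection : Bijection Y (Omega₁.setoid Ω)
    uncountable⇒bijection = record
      { to        = index
      -- The stage `index` is an arbitrary classical choice; that it respects equality comes from
      -- the injectivity of `enum`.
      ; cong      = λ {x} {y} x≈y → enum-injective (wellFounded _) (wellFounded _)
                      (≈-trans (≈-sym (listed x)) (≈-trans x≈y (listed y)))
      ; bijective =
          (λ {x} {y} eq → ≈-trans (listed x)
            (≈-trans (enum-cong (wellFounded _) (wellFounded _) eq) (≈-sym (listed y))))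
        , (λ α → enum (wellFounded α) , λ {z} z≈ →
            enum-injective (wellFounded _) (wellFounded _) (≈-trans (≈-sym (listed z)) z≈))
      }
      where
      index : E → W
      index y = proj₁ (enum-surjective y)

      listed : ∀ y → y ≈ enum (wellFounded (index y))
      listed y = proj₂ (enum-surjective y)

-- Rational bounds on reals.

open ℝ using (cut)

cut<¬cut : (x : ℝ) {s t : ℚ} → cut x s → ¬ cut x t → s ℚ.< t
cut<¬cut x {s} {t} s∈x t∉x with ℚ.<-cmp s t
... | tri< s<t _ _  = s<t
... | tri≈ _ refl _ = ⊥-elim (t∉x s∈x)
... | tri> _ _ t<s  = ⊥-elim (t∉x (ℝ.lower x t<s s∈x))

ℚ→ℝ : ℚ → ℝ
ℚ→ℝ t = record
  { cut       = ℚ._< t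
  ; inhabited = t ℚ.- 1ℚ , ≡.subst (t ℚ.- 1ℚ ℚ.<_) (ℚ.+-identityʳ t)
                             (ℚ.+-monoʳ-< t (ℚ.negative⁻¹ (ℚ.- 1ℚ)))
  ; bounded   = t , ℚ.<-irrefl refl
  ; lower     = ℚ.<-trans
  ; rounded   = ℚ.<-dense
  }

½+½ : ∀ t → t ℚ.* ½ ℚ.+ t ℚ.* ½ ≡ t
½+½ t = ≡.trans (≡.sym (ℚ.*-distribˡ-+ t ½ ½)) (ℚ.*-identityʳ t)

half-positive : ∀ {t} → 0ℚ ℚ.< t → 0ℚ ℚ.< t ℚ.* ½
half-positive 0<t = ℚ.*-monoˡ-<-pos ½ 0<t

<-difference : ∀ {s t} → s ℚ.< t → 0ℚ ℚ.< ℚ.- s ℚ.+ t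
<-difference {s} {t} s<t = ≡.subst (ℚ._< ℚ.- s ℚ.+ t) (ℚ.+-inverseˡ s) (ℚ.+-monoʳ-< (ℚ.- s) s<t)

+-difference : ∀ s t → s ℚ.+ (ℚ.- s ℚ.+ t) ≡ t
+-difference s t = begin
  s ℚ.+ (ℚ.- s ℚ.+ t)  ≡⟨ ℚ.+-assoc s (ℚ.- s) t ⟨
  (s ℚ.- s) ℚ.+ t      ≡⟨ ≡.cong (ℚ._+ t) (ℚ.+-inverseʳ s) ⟩
  0ℚ ℚ.+ t             ≡⟨ ℚ.+-identityˡ t ⟩
  t                    ∎
  where open ≡.≡-Reasoning

-- The members need not be open.
record CountableNetwork {X : Setoid c ℓ} (T : Topology X o) : Set (Level.suc (c ⊔ ℓ) ⊔ o) where
  field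
    Index     : Set
    countable : Index ↣ ℕ
    member    : Index → Subset X (c ⊔ ℓ)
    refines   : ∀ {V x} → Topology.Open T V → V x →
                ∃[ i ] (Subset.pred (member i) x × Subset.pred (member i) ⊆ V)

-- Balls in a metric space, and a countable network from separability.

module MetricTopology {X : Setoid c ℓ} (T : Topology X o)
         (d : Setoid.Carrier X → Setoid.Carrier X → ℝ)
         (metric : IsMetric X d) (induces : Induces X d T) where
  open Setoid X renaming (Carrier to E; refl to ≈-refl; sym to ≈-sym; trans to ≈-trans)
  open Topology T using (Open)
  open IsGeneralMetric metric using (cong; triangle; ≈⇒0; 0⇒≈; nonNegative)
    renaming (sym to d-sym)

  -- The closed ball of rational radius: a rational outside the lower cut of `d x y` is an upper
  -- bound for the distance.
  _within_of_ : E → ℚ → E → Set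
  y within t of x = ¬ cut (d x y) t

  within-resp : ∀ {x x′ y y′ t} → x ≈ x′ → y ≈ y′ → y within t of x → y′ within t of x′
  within-resp x≈x′ y≈y′ y∈ t∈ = y∈ (proj₂ (cong x≈x′ y≈y′) t∈)

  within-sym : ∀ {x y t} → y within t of x → x within t of y
  within-sym {x} {y} y∈ t∈ = y∈ (proj₂ (d-sym x y) t∈)

  within-mono : ∀ {x y s t} → s ℚ.< t → y within s of x → y within t of x
  within-mono {x} {y} s<t y∈ t∈ = y∈ (ℝ.lower (d x y) s<t t∈)

  within-triangle : ∀ {x y z s t} → y within s of x → z within t of y → z within (s ℚ.+ t) of x
  within-triangle {x} {y} {z} {s} {t} y∈ z∈ st∈ with triangle x y z st∈
  ... | s′ , t′ , s′∈ , t′∈ , eq =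
    ℚ.<-irrefl (≡.sym eq) (ℚ.+-mono-< (cut<¬cut (d x y) s′∈ y∈) (cut<¬cut (d y z) t′∈ z∈))

  within-centre : ∀ x → x within 0ℚ of x
  within-centre x 0∈ = ℚ.<-irrefl refl (proj₁ (≈⇒0 {x} {x} ≈-refl) 0∈)

  ball : E → ℚ → Pred E (c ⊔ ℓ)
  ball x t y = Lift (c ⊔ ℓ) (∃[ s ] (s ℚ.< t × y within s of x))

  ball-open : ∀ x t → Open (ball x t)
  ball-open x t = Equivalence.from (induces (ball x t))
    ( (λ y≈y′ (lift (s , s<t , y∈)) → lift (s , s<t , within-resp ≈-refl y≈y′ y∈))
    , λ (lift (s , s<t , y∈)) →
        -- The bound `s` on the distance to the centre leaves room for a ball of radius t - s.
        ℚ→ℝ (ℚ.- s ℚ.+ t) , (0ℚ , <-difference s<t , ℚ.<-irrefl refl)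
        , λ (u , u<t-s , z∈) → lift
            ( s ℚ.+ u
            , ≡.subst (s ℚ.+ u ℚ.<_) (+-difference s t) (ℚ.+-monoʳ-< s u<t-s)
            , within-triangle y∈ z∈) )

  open⇒ball : ∀ {V x} → Open V → V x → ∃[ t ] (0ℚ ℚ.< t × (∀ {y} → y within t of x → V y))
  open⇒ball {V} V-open x∈V with proj₂ (Equivalence.to (induces V) V-open) x∈V
  ... | ε , (s , s∈ε , s≮0) , ball⊆V with ℝ.rounded ε s∈ε
  -- The witness `s` may be 0; roundedness of the cut gives a larger `t`, which is strictly
  -- positive.
  ...   | t , s<t , t∈ε = t , ℚ.≤-<-trans (ℚ.≮⇒≥ s≮0) s<t , λ y∈ → ball⊆V (t , t∈ε , y∈)

  module _ (em : ∀ {e : Level} → ExcludedMiddle e) where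

    -- The ball about x of radius `d x y` misses y. This radius is positive, since otherwise its cut
    -- would be that of 0 and x would equal y.
    complement-open : ∀ y → Open (λ x → Lift c (¬ x ≈ y))
    complement-open y = Equivalence.from (induces _)
      ( (λ x≈x′ (lift x≉y) → lift λ x′≈y → x≉y (≈-trans x≈x′ x′≈y))
      , λ {x} (lift x≉y) → d x y , positive x≉y
          , λ {z} (t , t∈ , t∉) → lift λ z≈y → t∉ (proj₁ (cong ≈-refl (≈-sym z≈y)) t∈) )
      where
      positive : ∀ {x} → ¬ x ≈ y → 0ᴿ <ᴿ d x y
      positive {x} x≉y = decidable-stable em λ ∄ → x≉y (0⇒≈
        ((λ {s} s∈ → decidable-stable em λ s≮0 → ∄ (s , s∈ , s≮0)) , nonNegative {x} {y}))

  -- The members are closed balls of rational radius about points of the dense set, each centre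
  -- being named by its code. If the ball of radius t about x lies in V, a dense point within t/2 of
  -- x gives a ball of radius t/2 that contains x and stays in V.
  separable⇒network : Separable T → CountableNetwork T
  separable⇒network (D , count , dense) = record
    { Index     = ℕ × ℚ
    ; countable = ×-countable ↣-refl ℚ-countable
    ; member    = member
    ; refines   = refines
    }
    where
    member : ℕ × ℚ → Subset X (c ⊔ ℓ)
    member (m , t) = record
      { pred = λ y → ∃[ z ] Σ[ z∈D ∈ Subset.pred D z ]
                 (Injection.to count (z , z∈D) ≡ m × y within t of z)
      ; resp = λ y≈y′ (z , z∈D , eq , y∈) → z , z∈D , eq , within-resp ≈-refl y≈y′ y∈
      }

    refines : ∀ {V x} → Open V → V x →
              ∃[ i ] (Subset.pred (member i) x × Subset.pred (member i) ⊆ V)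
    refines {V} {x} V-open x∈V
      with t , 0<t , ball⊆V ← open⇒ball V-open x∈V
      with z , z∈D , lift (s , s<t/2 , z∈) ← dense (ball-open x (t ℚ.* ½))
             (x , lift (0ℚ , half-positive 0<t , within-centre x))
      = (Injection.to count (z , z∈D) , t ℚ.* ½)
      , (z , z∈D , refl , within-sym (within-mono s<t/2 z∈))
      , λ {y} (z′ , z′∈D , eq , y∈) → ball⊆V (≡.subst (λ u → y within u of x) (½+½ t)
          (within-triangle (within-mono s<t/2 z∈)
            (within-resp (Injection.injective count eq) ≈-refl y∈)))

-- Continuity of terms in a Polish group.

module PolishTopology (em : ∀ {e : Level} → ExcludedMiddle e) (G : PolishGroup c ℓ o) where
  open PolishGroup G renaming (Carrier to E) hiding (refl)
  open Topology topology
  open GroupProperties group using (x≈y⇒x∙y⁻¹≈ε; x∙y⁻¹≈ε⇒x≈y)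

  open MetricTopology topology (proj₁ completelyMetrizable)
    (proj₁ (proj₂ completelyMetrizable)) (proj₂ (proj₂ (proj₂ completelyMetrizable)))

  network : CountableNetwork topology
  network = separable⇒network separable

  module _ {V : Set} where

    -- Neighbourhoods of an assignment are taken as boxes so that each coordinate can later be
    -- shrunk to a network member on its own.
    record OpenBox (ρ : V → E) (P : Pred (V → E) p) : Set (Level.suc (c ⊔ ℓ) ⊔ o ⊔ p) where
      field
        side   : V → Pred E (c ⊔ ℓ)
        isOpen : ∀ v → Open (side v)
        centre : ∀ v → side v (ρ v)
        inside : ∀ {ρ′} → (∀ v → side v (ρ′ v)) → P ρ′

    term-continuous : (t : Term V) (ρ : V → E) {W : Pred E (c ⊔ ℓ)} →
                      Open W → W (⟦_⟧ group t ρ) → OpenBox ρ (λ ρ′ → W (⟦_⟧ group t ρ′))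
    term-continuous (var v) ρ {W} W-open ∈W = record
      { side   = λ w → side w em
      ; isOpen = λ w → side-open w em
      ; centre = λ w → side-centre w em
      ; inside = λ ρ′∈ → inside em (ρ′∈ v)
      }
      where
      -- Only the coordinate `v` is constrained. The decision is an argument so that the
      -- accompanying proofs can split on it.
      side : ∀ w → Dec (v ≡ w) → Pred E (c ⊔ ℓ)
      side _ (yes _) = W
      side _ (no _)  = U

      side-open : ∀ w v≟w → Open (side w v≟w)
      side-open _ (yes _) = W-open
      side-open _ (no _)  = open-U

      side-centre : ∀ w v≟w → side w v≟w (ρ w)
      side-centre _ (yes refl) = ∈W
      side-centre _ (no _)     = tt

      inside : ∀ {x} v≟v → side v v≟v x → W x
      inside (yes _)  x∈W = x∈W
      inside (no v≢v) _   = ⊥-elim (v≢v refl)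
    term-continuous e ρ W-open ∈W = record
      { side = λ _ → U ; isOpen = λ _ → open-U ; centre = λ _ → tt ; inside = λ _ → ∈W }
    term-continuous (t · u) ρ W-open ∈W
      with _ , _ , V₁-open , V₂-open , ∈V₁ , ∈V₂ , V₁×V₂⊆ ← ∙-continuous W-open ∈W = record
      { side   = λ v x → B₁.side v x × B₂.side v x
      ; isOpen = λ v → open-∩ (B₁.isOpen v) (B₂.isOpen v)
      ; centre = λ v → B₁.centre v , B₂.centre v
      ; inside = λ ρ′∈ → V₁×V₂⊆ (B₁.inside (proj₁ ∘ ρ′∈) , B₂.inside (proj₂ ∘ ρ′∈))
      }
      where
      module B₁ = OpenBox (term-continuous t ρ V₁-open ∈V₁)
      module B₂ = OpenBox (term-continuous u ρ V₂-open ∈V₂)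
    term-continuous (t ⁻¹′) ρ W-open ∈W = record { OpenBox (term-continuous t ρ (⁻¹-continuous W-open) ∈W) }

    -- The two sides differ exactly when `t · (u ⁻¹′)` avoids the identity, so continuity of a
    -- single term and openness of the complement of a point suffice.
    disequation-open : ∀ t u (ρ : V → E) → ¬ _⊨_[_] group (t ≐′ u) ρ →
                       OpenBox ρ (λ ρ′ → ¬ _⊨_[_] group (t ≐′ u) ρ′)
    disequation-open t u ρ t≉u = record
      { side   = B.side
      ; isOpen = B.isOpen
      ; centre = B.centre
      ; inside = λ ρ′∈ t≈u → lower (B.inside ρ′∈) (x≈y⇒x∙y⁻¹≈ε t≈u)
      }
      where
      module B = OpenBox (term-continuous (t · (u ⁻¹′)) ρ (complement-open em ε)
                                          (lift (t≉u ∘ x∙y⁻¹≈ε⇒x≈y _ _)))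

-- Uncountable subfamilies deciding formulas.

module Homogeneity (em : ∀ {e : Level} → ExcludedMiddle e) (G : PolishGroup c ℓ o)
                   {k : ℕ} (n : Fin k → ℕ) (X : Fin k → Setoid b i)
                   (g : ∀ l → Func (X l) (PolishGroup.group G ^ᵍ n l)) (p : Level) where
  open PolishGroup G using (group) renaming (Carrier to E)
  open Classical em
  open PolishTopology em G
  open CountableNetwork network using (Index; countable; member; refines)

  Family : Set (b ⊔ i ⊔ Level.suc p)
  Family = ∀ l → Subset (X l) p

  Uncountable : Family → Set (b ⊔ i ⊔ p)
  Uncountable S = ∀ l → ¬ Countable ⟪ S l ⟫

  infix 4 _⊑_
  _⊑_ : Family → Family → Set (b ⊔ p)
  S ⊑ T = ∀ l → Subset.pred (S l) ⊆ Subset.pred (T l)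

  Choice : Family → Set (b ⊔ p)
  Choice S = ∀ l → Setoid.Carrier ⟪ S l ⟫

  assignment : (∀ l → Setoid.Carrier (X l)) → Var n → E
  assignment α (l , i) = Func.to (g l) (α l) i

  infix 4 _⊩_
  _⊩_ : (∀ l → Setoid.Carrier (X l)) → QFFormula (Var n) → Set ℓ
  α ⊩ φ = _⊨_[_] group φ (assignment α)

  data Homogeneous (S : Family) (φ : QFFormula (Var n)) : Set (b ⊔ p ⊔ ℓ) where
    holds : (∀ (α : Choice S) → proj₁ ∘ α ⊩ φ) → Homogeneous S φ
    fails : (∀ (α : Choice S) → ¬ (proj₁ ∘ α ⊩ φ)) → Homogeneous S φ

  Homogeneous-antitone : ∀ {S T φ} → S ⊑ T → Homogeneous T φ → Homogeneous S φ
  Homogeneous-antitone S⊑T (holds h) = holds λ α → h λ l → proj₁ (α l) , S⊑T l (proj₂ (α l))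
  Homogeneous-antitone S⊑T (fails h) = fails λ α → h λ l → proj₁ (α l) , S⊑T l (proj₂ (α l))

  record Refinement (S : Family) (P : Family → Set q) : Set (b ⊔ i ⊔ Level.suc p ⊔ q) where
    field
      family      : Family
      uncountable : Uncountable family
      refinement  : family ⊑ S
      property    : P family

  box : ∀ l → Vec Index (n l) → Subset (X l) (c ⊔ ℓ)
  box l v = record
    { pred = λ x → ∀ i → Subset.pred (member (lookup v i)) (Func.to (g l) x i)
    ; resp = λ x≈y x∈ i → Subset.resp (member (lookup v i)) (Func.cong (g l) x≈y i) (x∈ i)
    }

  equation-homogeneous : ∀ t u S → Uncountable S → Refinement S (λ T → Homogeneous T (t ≐′ u))
  equation-homogeneous t u S S-unc
    with em {P = ∃[ α ] ((∀ l → Subset.pred (condensation (S l) (box l)) (α l)) × ¬ (α ⊩ t ≐′ u))}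
  ... | no ∄ = record
    { family      = λ l → resize (cond l)
    ; uncountable = λ l → resize-uncountable (cond l)
                      (condensation-uncountable (S l) (box l) (Vec-countable countable (n l)) (S-unc l))
    ; refinement  = λ l x∈ → proj₁ (resize-⊆ {S = cond l} x∈)
    ; property    = holds λ α → dne λ t≉u →
                      ∄ (proj₁ ∘ α , (λ l → resize-⊆ {S = cond l} (proj₂ (α l))) , t≉u)
    }
    where
    cond : ∀ l → Subset (X l) _
    cond l = condensation (S l) (box l)
  ... | yes (α , α∈ , t≉u) = record
    { family      = λ l → resize (near l)
    -- The condensation point `α l` lies in the chosen box, which therefore meets `S l` in an
    -- uncountable set.
    ; uncountable = λ l → resize-uncountable (near l)
                      (proj₂ (α∈ l) (index l) λ i → proj₁ (index-refines l i))
    ; refinement  = λ l x∈ → proj₁ (resize-⊆ {S = near l} x∈)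
    ; property    = fails λ β → inside λ (l , i) → proj₂ (index-refines l i)
                      (proj₂ (resize-⊆ {S = near l} (proj₂ (β l))) i)
    }
    where
    open OpenBox (disequation-open t u (assignment α) t≉u)

    indices : ∀ l → ∃[ v ] (∀ i → Subset.pred (member (lookup v i)) (Func.to (g l) (α l) i) ×
                                  Subset.pred (member (lookup v i)) ⊆ side (l , i))
    indices l = Vec-choice λ i → refines (isOpen (l , i)) (centre (l , i))

    index : ∀ l → Vec Index (n l)
    index l = proj₁ (indices l)

    index-refines : ∀ l i → Subset.pred (member (lookup (index l) i)) (Func.to (g l) (α l) i) ×
                            Subset.pred (member (lookup (index l) i)) ⊆ side (l , i)
    index-refines l = proj₂ (indices l)

    near : ∀ l → Subset (X l) _
    near l = S l ∩ˢ box l (index l)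

  -- The second refinement is made inside the first, so the first property has to survive shrinking.
  refine-both : {P : Family → Set q} {Q : Family → Set r} {R : Family → Set s} →
                (∀ {S T} → S ⊑ T → P T → P S) → (∀ {S} → P S → Q S → R S) →
                (∀ S → Uncountable S → Refinement S P) → (∀ S → Uncountable S → Refinement S Q) →
                ∀ S → Uncountable S → Refinement S R
  refine-both antitone combine refineP refineQ S S-unc = record
    { family      = R₂.family
    ; uncountable = R₂.uncountable
    ; refinement  = λ l → R₁.refinement l ∘ R₂.refinement l
    ; property    = combine (antitone R₂.refinement R₁.property) R₂.property
    }
    where
    module R₁ = Refinement (refineP S S-unc)
    module R₂ = Refinement (refineQ R₁.family R₁.uncountable)

  homogeneous : ∀ φ S → Uncountable S → Refinement S (λ T → Homogeneous T φ)
  homogeneous (t ≐′ u) S S-unc = equation-homogeneous t u S S-unc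
  homogeneous (¬′ φ)   S S-unc = record
    { family = family ; uncountable = uncountable ; refinement = refinement ; property = negate property }
    where
    open Refinement (homogeneous φ S S-unc)
    negate : ∀ {T} → Homogeneous T φ → Homogeneous T (¬′ φ)
    negate (holds h) = fails λ α ¬φ → ¬φ (h α)
    negate (fails h) = holds h
  homogeneous (φ ∧′ ψ) = refine-both Homogeneous-antitone combine (homogeneous φ) (homogeneous ψ)
    where
    combine : ∀ {S} → Homogeneous S φ → Homogeneous S ψ → Homogeneous S (φ ∧′ ψ)
    combine (holds h) (holds h′) = holds λ α → h α , h′ α
    combine (holds _) (fails h′) = fails λ α (_ , y) → h′ α y
    combine (fails h) _         = fails λ α (x , _) → h α x
  homogeneous (φ ∨′ ψ) = refine-both Homogeneous-antitone combine (homogeneous φ) (homogeneous ψ)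
    where
    combine : ∀ {S} → Homogeneous S φ → Homogeneous S ψ → Homogeneous S (φ ∨′ ψ)
    combine (holds h) _         = holds λ α → inj₁ (h α)
    combine (fails _) (holds h′) = holds λ α → inj₂ (h′ α)
    combine (fails h) (fails h′) = fails λ { α (inj₁ x) → h α x ; α (inj₂ y) → h′ α y }
  homogeneous (φ ⇒′ ψ) = refine-both Homogeneous-antitone combine (homogeneous φ) (homogeneous ψ)
    where
    combine : ∀ {S} → Homogeneous S φ → Homogeneous S ψ → Homogeneous S (φ ⇒′ ψ)
    combine (fails h) _         = holds λ α x → ⊥-elim (h α x)
    combine (holds _) (holds h′) = holds λ α _ → h′ α
    combine (holds h) (fails h′) = fails λ α f → h′ α (f (h α))

  all-homogeneous : ∀ Δ S → Uncountable S → Refinement S (λ T → All (Homogeneous T) Δ)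
  all-homogeneous []      S S-unc = record
    { family = S ; uncountable = S-unc ; refinement = λ _ x∈S → x∈S ; property = [] }
  all-homogeneous (φ ∷ Δ) =
    refine-both Homogeneous-antitone _∷_ (homogeneous φ) (all-homogeneous Δ)

  -- Deciding the universal statement itself gives a value at every formula, including those outside
  -- `Δ`, where homogeneity is not known.
  truthValue : Family → QFFormula (Var n) → Bool
  truthValue S φ = does (em {P = ∀ (α : Choice S) → proj₁ ∘ α ⊩ φ})

  truthValue-correct : ∀ {S} φ → Homogeneous S φ → (α : Choice S) → proj₁ ∘ α ⊩ φ ^ truthValue S φ
  truthValue-correct {S} φ hom with em {P = ∀ (α : Choice S) → proj₁ ∘ α ⊩ φ} | hom
  ... | yes h  | _      = h
  ... | no  ¬h | holds h = ⊥-elim (¬h h)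
  ... | no  _  | fails h = h

-- From uncountable subfamilies to subsets of cardinality ℵ₁.

theorem2p1 : (∀ {e : Level} → ExcludedMiddle e) →
    ∀ {a r s c ℓ o p : Level}
    (Ω : Omega₁ a r s)
    (G : PolishGroup c ℓ o) (let open PolishGroup G using (group))
    (k : ℕ)
    (n : Fin k → ℕ)
    (A : Fin k → ℵ₁-Subset Ω (Omega₁.setoid Ω) p)
    (g : ∀ l → Func (ℵ₁-Subset.elements (A l)) (group ^ᵍ n l))
    (Δ : List (QFFormula (Var n))) →
    Σ[ B ∈ (∀ l → ℵ₁-Subset Ω (ℵ₁-Subset.elements (A l)) p) ]
    Σ[ t ∈ (QFFormula (Var n) → Bool) ]
    (∀ φ → φ ∈ Δ →
    (α : ∀ l → Setoid.Carrier (ℵ₁-Subset.elements (B l))) →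
    group ⊨ φ ^ t φ [ (λ (l , i) → Func.to (g l) (proj₁ (α l)) i) ])
theorem2p1 em {p = p} Ω G k n A g Δ =
  (λ l → record { subset = family l ; card = card l }) , truthValue family ,
  λ φ φ∈Δ → truthValue-correct φ (All.lookup property φ∈Δ)
  where
  open Classical em
  open Homogeneity em G n (ℵ₁-Subset.elements ∘ A) g p

  whole : Family
  whole l = record { pred = U ; resp = λ _ _ → tt }

  whole-uncountable : Uncountable whole
  whole-uncountable l count = Omega₁.uncountable Ω (↣-trans
    (Inverse.Inverse⇒Injection (Inverse.sym (Bijection⇒Inverse (ℵ₁-Subset.card (A l)))))
    (↣-trans {T = ⟪ whole l ⟫}
      record { to = λ x → x , tt ; cong = λ x≈y → x≈y ; injective = λ x≈y → x≈y } count))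

  open Refinement (all-homogeneous Δ whole whole-uncountable)

  -- A subset of `A l` inherits an injection into ω₁, so being uncountable it has cardinality ℵ₁ by
  -- the transfinite enumeration.
  card : ∀ l → Bijection ⟪ family l ⟫ (Omega₁.setoid Ω)
  card l = uncountable⇒bijection Ω
    (↣-trans (⟪⟫-embed (family l)) (Bijection.injection (ℵ₁-Subset.card (A l))))
    (uncountable l)
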